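{- Let $k,t$ be integers with $k\geq 5$ and $k=t$. Then $$\operatorname{gr}_k(P_5:K_t)=(t-1)^2+1 .$$
   Context: All graphs are finite, simple and undirected. $K_n$ is the complete graph on $n$ vertices and $P_5$ is the path with $5$ vertices and $4$ edges. A $k$-edge-coloring assigns to each edge one of $k$ colors; all $k$-edge-colorings are assumed exact, i.e. each of the $k$ colors is used at least once. An edge-colored graph is rainbow if all its edges have different colors and monochromatic if all its edges have a single color. A copy of a graph means a (not necessarily induced) subgraph isomorphic to it. For non-empty graphs $G,H$ (graphs with at least one edge) and a positive integer $k$, the Gallai-Ramsey number $\operatorname{gr}_k(G:H)$ is the minimum integer $N$ with $\binom{N}{2}\geq k$ (so that $K_N$ admits a $k$-edge-coloring) such that for all $n\geq N$, every $k$-edge-coloring of $K_n$ contains either a rainbow copy of $G$ or a monochromatic copy of $H$. -}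

module Defs where

open import Data.Fin using (Fin; toℕ)
open import Data.Fin.Properties using () renaming (_≟_ to _≟ᶠ_)
open import Data.Nat using (ℕ; suc; _≤_; _≥_)
open import Data.Nat.Combinatorics using (_C_)
open import Data.Nat.Properties using (_≟_; 1+n≢n)
open import Data.Product using (∃-syntax; Σ-syntax; _×_)
open import Data.Sum using (_⊎_; inj₁; inj₂; swap)
open import Function.Definitions using (Injective)
open import Level using (0ℓ)
open import Relation.Binary.Core using (Rel)
open import Relation.Binary.Definitions using (Symmetric; Irreflexive; Decidable)
open import Relation.Binary.PropositionalEquality using (_≡_; _≢_; refl; ≢-sym)
open import Relation.Nullary.Decidable using (¬?; _⊎-dec_)

record Graph : Set₁ where
  field
    order  : ℕ
    Adj    : Rel (Fin order) 0ℓ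
    sym    : Symmetric Adj
    irrefl : Irreflexive _≡_ Adj
    adj?   : Decidable Adj

  Vertex : Set
  Vertex = Fin order

open Graph using (Vertex; Adj)

K : ℕ → Graph
K n = record
  { order  = n
  ; Adj    = _≢_
  ; sym    = ≢-sym
  ; irrefl = λ u≡v u≢v → u≢v u≡v
  ; adj?   = λ u v → ¬? (u ≟ᶠ v)
  }

-- P n is the path with n vertices (not n edges).
P : ℕ → Graph
P n = record
  { order  = n
  ; Adj    = λ u v → suc (toℕ u) ≡ toℕ v ⊎ suc (toℕ v) ≡ toℕ u
  ; sym    = swap
  ; irrefl = λ { refl (inj₁ eq) → 1+n≢n eq ; refl (inj₂ eq) → 1+n≢n eq }
  ; adj?   = λ u v → (suc (toℕ u) ≟ toℕ v) ⊎-dec (suc (toℕ v) ≟ toℕ u)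
  }

-- An exact k-edge-coloring.  Since e and e′ in color-sym are arbitrary
-- adjacency proofs, the color depends only on the unordered pair {u , v}:
-- two proofs of Adj F u v get the same color, namely that of any proof of
-- Adj F v u.
record EdgeColoring (k : ℕ) (F : Graph) : Set where
  field
    color     : ∀ {u v} → Adj F u v → Fin k
    color-sym : ∀ {u v} (e : Adj F u v) (e′ : Adj F v u) → color e ≡ color e′
    exact     : ∀ i → ∃[ u ] ∃[ v ] Σ[ e ∈ Adj F u v ] color e ≡ i

open EdgeColoring using (color)

-- A (not necessarily induced) subgraph of F isomorphic to G, given by the
-- isomorphism from G onto it; its edges are the images of the edges of G.
record Copy (G F : Graph) : Set where
  field
    vertex    : Vertex G → Vertex F
    injective : Injective _≡_ _≡_ vertex
    edge      : ∀ {u v} → Adj G u v → Adj F (vertex u) (vertex v)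

open Copy using (edge)

module _ {k : ℕ} {G F : Graph} (c : EdgeColoring k F) (S : Copy G F) where

  -- Edges are unordered, so uv and u′v′ are the same edge also when
  -- u ≡ v′ and v ≡ u′.
  Rainbow : Set
  Rainbow = ∀ {u v u′ v′} (e : Adj G u v) (e′ : Adj G u′ v′) →
            color c (edge S e) ≡ color c (edge S e′) →
            (u ≡ u′ × v ≡ v′) ⊎ (u ≡ v′ × v ≡ u′)

  Monochromatic : Set
  Monochromatic = ∃[ i ] (∀ {u v} (e : Adj G u v) → color c (edge S e) ≡ i)

IsMinimum : (ℕ → Set) → ℕ → Set
IsMinimum Q N = Q N × (∀ M → Q M → N ≤ M)

GallaiRamseyBound : ℕ → Graph → Graph → ℕ → Set
GallaiRamseyBound k G H N =
  N C 2 ≥ k ×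
  (∀ n → n ≥ N → (c : EdgeColoring k (K n)) →
    (Σ[ S ∈ Copy G (K n) ] Rainbow c S) ⊎
    (Σ[ S ∈ Copy H (K n) ] Monochromatic c S))

-- gr[ k , G ∶ H ]≡ N states that gr_k(G : H) exists and equals N.
gr[_,_∶_]≡_ : ℕ → Graph → Graph → ℕ → Set
gr[ k , G ∶ H ]≡ N = IsMinimum (GallaiRamseyBound k G H) N

{-# OPTIONS --safe #-}
module Submission where

-- Lower bound: take t − 1 blocks of t − 1 vertices, each block a clique of its
-- own colour, with one further colour between the blocks.
--
-- Upper bound: fix an exact colouring without rainbow P₅.  If some vertex a sees
-- at least three colours, then: should a see all colours, one neighbour of a for
-- each colour yields a monochromatic K_t; should exactly one colour c be unseen
-- at a, all edges avoiding a have colour c; and two colours unseen at a give a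
-- rainbow P₅.  If every vertex sees at most two colours, then some colour d is
-- seen everywhere, and the vertices are classified by their other colour.  Edges
-- between classes have colour d, so either a class of t vertices is monochromatic
-- or t vertices of colour d can be picked across the t − 1 classes, using two from
-- one class or a vertex that sees only d.

open import Data.Empty using (⊥; ⊥-elim)
open import Data.Fin using (Fin; zero; suc; toℕ; fromℕ<; inject₁; inject≤; punchIn; punchOut; combine;
  remQuot)
open import Data.Fin.Properties as Fin
  using (_≟_; any?; all?; ¬∀⟶∃¬; pigeonhole; injective⇒≤; combine-injective; remQuot-combine;
         combine-remQuot; inject≤-injective; punchIn-injective; punchInᵢ≢i; punchOut-injective;
         toℕ-injective; toℕ-inject₁; toℕ-inject≤)
open import Data.List using (List; []; _∷_; length; lookup; filter; allFin)
open import Data.List.Membership.Propositional using (_∈_)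
open import Data.List.Membership.Propositional.Properties using (∈-lookup; ∈-allFin; ∈-filter⁺; ∈-filter⁻)
open import Data.List.Relation.Unary.All as All using ([]; _∷_)
open import Data.List.Relation.Unary.AllPairs using ([]; _∷_)
open import Data.List.Relation.Unary.Any using (index)
open import Data.List.Relation.Unary.Any.Properties using (lookup-index)
open import Data.List.Relation.Unary.Unique.DecPropositional using (unique?)
open import Data.List.Relation.Unary.Unique.Propositional using (Unique)
open import Data.List.Relation.Unary.Unique.Propositional.Properties using (allFin⁺; filter⁺)
open import Data.Nat using (ℕ; zero; suc; _+_; _*_; _∸_; _^_; _≤_; _<_; _≥_; z≤n; s≤s)
open import Data.Nat.Combinatorics using (_C_; nC1≡n; nCk+nC[k+1]≡[n+1]C[k+1])
import Data.Nat.Properties as ℕ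
open import Data.Product using (∃₂; ∃-syntax; Σ-syntax; _×_; _,_; proj₁; proj₂; uncurry)
open import Data.Sum using (_⊎_; inj₁; inj₂; [_,_]′)
open import Function using (_∘_)
open import Function.Definitions using (Injective)
open import Relation.Binary.PropositionalEquality
  using (_≡_; _≢_; refl; sym; trans; cong; cong₂; subst; ≢-sym)
open import Relation.Nullary using (¬_; Dec; yes; no; contradiction)
open import Relation.Nullary.Decidable using (¬?; _×-dec_; decidable-stable)
open import Defs

private variable
  k m n : ℕ

-- Injections and pigeonhole arguments on finite sets.

lookup-injective : ∀ {A : Set} {xs : List A} → Unique xs → Injective _≡_ _≡_ (lookup xs)
lookup-injective (_ ∷ _)     {zero}  {zero}  _  = refl
lookup-injective (x∉xs ∷ _)  {zero}  {suc j} eq = contradiction eq (All.lookup x∉xs (∈-lookup j))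
lookup-injective (x∉xs ∷ _)  {suc i} {zero}  eq = contradiction (sym eq) (All.lookup x∉xs (∈-lookup i))
lookup-injective (_ ∷ uniq)  {suc i} {suc j} eq = cong suc (lookup-injective uniq eq)

fresh : 5 ≤ n → (p q r s : Fin n) → ∃[ i ] i ≢ p × i ≢ q × i ≢ r × i ≢ s
fresh {n} 5≤n p q r s = missed
  where
  xs : List (Fin n)
  xs = p ∷ q ∷ r ∷ s ∷ []

  hit? : ∀ i → Dec (∃[ x ] lookup xs x ≡ i)
  hit? i = any? (λ x → lookup xs x ≟ i)

  notAll : ¬ (∀ i → ∃[ x ] lookup xs x ≡ i)
  -- Choosing a position for every element would inject `Fin n` into the four positions of `xs`.
  notAll all = ℕ.<⇒≱ 5≤n (injective⇒≤ {f = λ i → proj₁ (all i)} λ {i} {j} eq →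
    trans (sym (proj₂ (all i))) (trans (cong (lookup xs) eq) (proj₂ (all j))))

  missed : ∃[ i ] i ≢ p × i ≢ q × i ≢ r × i ≢ s
  missed with ¬∀⟶∃¬ n _ hit? notAll
  ... | i , ¬hit = i , (λ eq → ¬hit (zero , sym eq)) , (λ eq → ¬hit (suc zero , sym eq))
                     , (λ eq → ¬hit (suc (suc zero) , sym eq))
                     , (λ eq → ¬hit (suc (suc (suc zero)) , sym eq))

avoiding : ∀ {n t} (a : Fin n) → t < n →
  Σ[ h ∈ (Fin t → Fin n) ] Injective _≡_ _≡_ h × (∀ i → h i ≢ a)
avoiding {suc n} a (s≤s t≤n) = (λ i → punchIn a (inject≤ i t≤n)) ,
  (λ eq → inject≤-injective t≤n t≤n _ _ (punchIn-injective a _ _ eq)) ,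
  (λ i → punchInᵢ≢i a (inject≤ i t≤n))

-- If every fibre had at most `r` elements, sending `v` to its value and its position in the fibre
-- would inject `Fin n` into `Fin (m * r)`.
generalized-pigeonhole : ∀ {n m r} (f : Fin n → Fin m) → m * r < n →
  ∃[ j ] Σ[ h ∈ (Fin (suc r) → Fin n) ] Injective _≡_ _≡_ h × (∀ i → f (h i) ≡ j)
generalized-pigeonhole {n} {m} {r} f mr<n = result
  where
  fibre : Fin m → List (Fin n)
  fibre j = filter (λ v → f v ≟ j) (allFin n)

  ∈fibre : ∀ v → v ∈ fibre (f v)
  ∈fibre v = ∈-filter⁺ (λ u → f u ≟ f v) (∈-allFin v) refl

  notAllSmall : ¬ (∀ j → length (fibre j) ≤ r)
  notAllSmall small = collide (pigeonhole mr<n position)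
    where
    position : Fin n → Fin (m * r)
    position v = combine (f v) (inject≤ (index (∈fibre v)) (small (f v)))

    -- Positions in two fibres have different types until `j ≡ j′` is matched, hence the comparison
    -- through `toℕ`.
    same-index : ∀ {j j′} → j ≡ j′ → (x : Fin (length (fibre j))) (y : Fin (length (fibre j′))) →
                 toℕ x ≡ toℕ y → lookup (fibre j) x ≡ lookup (fibre j′) y
    same-index {j} refl x y eq = cong (lookup (fibre j)) (toℕ-injective eq)

    collide : ¬ (∃₂ λ u v → Data.Fin._<_ u v × position u ≡ position v)
    collide (u , v , u<v , eq) with combine-injective (f u) _ (f v) _ eq
    ... | fu≡fv , iu≡iv = Fin.<⇒≢ u<v (trans (lookup-index (∈fibre u))
      (trans (same-index fu≡fv _ _ (trans (sym (toℕ-inject≤ _ (small (f u))))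
        (trans (cong toℕ iu≡iv) (toℕ-inject≤ _ (small (f v))))))
      (sym (lookup-index (∈fibre v)))))

  result : ∃[ j ] Σ[ h ∈ (Fin (suc r) → Fin n) ] Injective _≡_ _≡_ h × (∀ i → f (h i) ≡ j)
  result with ¬∀⟶∃¬ m _ (λ j → length (fibre j) Data.Nat.≤? r) notAllSmall
  ... | j , big = j , (λ i → lookup (fibre j) (inject≤ i r<)) ,
      (λ eq → inject≤-injective r< r< _ _
                (lookup-injective (filter⁺ (λ v → f v ≟ j) (allFin⁺ n)) eq)) ,
      (λ i → proj₂ (∈-filter⁻ (λ v → f v ≟ j) {xs = allFin n} (∈-lookup (inject≤ i r<))))
    where
    r< : suc r ≤ length (fibre j)
    r< = ℕ.≰⇒> big

-- Colourings are handled as total symmetric functions; the value on the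
-- diagonal is junk.
RainbowPath : (Fin n → Fin n → Fin k) → (a b c d e : Fin n) → Set
RainbowPath col a b c d e =
  Unique (a ∷ b ∷ c ∷ d ∷ e ∷ []) × Unique (col a b ∷ col b c ∷ col c d ∷ col d e ∷ [])

MonoClique : ℕ → (Fin n → Fin n → Fin k) → Set
MonoClique {n} t col =
  Σ[ h ∈ (Fin t → Fin n) ] Injective _≡_ _≡_ h × ∃[ i ] (∀ x y → x ≢ y → col (h x) (h y) ≡ i)

-- Colourings without a rainbow P₅, viewed from one vertex.

module RainbowFree
  (col : Fin n → Fin n → Fin k)
  (col-sym : ∀ u v → col u v ≡ col v u)
  (rainbowFree : ∀ a b c d e → ¬ RainbowPath col a b c d e)
  (5≤k : 5 ≤ k)
  where

  private variable
    p q r s : Fin k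

  edge-sym : ∀ {u v} → col u v ≡ p → col v u ≡ p
  edge-sym eq = trans (col-sym _ _) eq

  -- Vertices two steps apart differ because otherwise two consecutive edges would be one edge with
  -- two colours. Colours enter through equations so that known values can stand for them.
  noPath : ∀ {a b c d e} →
    a ≢ b → b ≢ c → c ≢ d → d ≢ e → a ≢ d → b ≢ e → a ≢ e →
    col a b ≡ p → col b c ≡ q → col c d ≡ r → col d e ≡ s →
    p ≢ q → p ≢ r → p ≢ s → q ≢ r → q ≢ s → r ≢ s → ⊥
  noPath {a = a} {b} {c} {d} {e} ab bc cd de ad be ae refl refl refl refl pq pr ps qr qs rs =
    rainbowFree a b c d e
      ( ( (ab ∷ (λ { refl → pq (col-sym a b) }) ∷ ad ∷ ae ∷ [])
        ∷ (bc ∷ (λ { refl → qr (col-sym b c) }) ∷ be ∷ [])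
        ∷ (cd ∷ (λ { refl → rs (col-sym c d) }) ∷ [])
        ∷ (de ∷ []) ∷ [] ∷ [])
      , ( (pq ∷ pr ∷ ps ∷ []) ∷ (qr ∷ qs ∷ []) ∷ (rs ∷ []) ∷ [] ∷ []))

  module Star (a : Fin n) where

    f : Fin n → Fin k
    f u = col a u

    f-sep : ∀ {u v} → f u ≢ f v → u ≢ v
    f-sep fu≢fv u≡v = fu≢fv (cong f u≡v)

    -- `noPath` for the path w, a, u, v, x, with the centre in second place.
    noTail : ∀ w u v x → w ≢ a → u ≢ a → x ≢ a → u ≢ v → v ≢ x → w ≢ v → w ≢ x →
      f w ≡ p → f u ≡ q → col u v ≡ r → col v x ≡ s →
      p ≢ q → p ≢ r → p ≢ s → q ≢ r → q ≢ s → r ≢ s → ⊥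
    noTail w u v x wa ua xa uv vx wv wx fw fu =
      noPath wa (≢-sym ua) uv vx wv (≢-sym xa) wx (edge-sym fw) fu

    -- `noPath` for the path x, u, a, v, y, with the centre in the middle.
    noMiddle : ∀ x u v y → u ≢ a → v ≢ a → x ≢ u → v ≢ y → x ≢ v → u ≢ y → x ≢ y →
      col x u ≡ p → f u ≡ q → f v ≡ r → col v y ≡ s →
      p ≢ q → p ≢ r → p ≢ s → q ≢ r → q ≢ s → r ≢ s → ⊥
    noMiddle x u v y ua va xu vy xv uy xy exu fu fv evy =
      noPath xu ua (≢-sym va) vy xv uy xy exu (edge-sym fu) fv evy

    Unseen : Fin k → Set
    Unseen c = ∀ u → u ≢ a → f u ≢ c

    -- The centre sees every colour.

    module AllSeen (b : Fin k → Fin n) (b≢a : ∀ i → b i ≢ a) (fb : ∀ i → f (b i) ≡ i) where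

      e : Fin k → Fin k → Fin k
      e i j = col (b i) (b j)

      e-sym : ∀ i j → e i j ≡ e j i
      e-sym i j = col-sym (b i) (b j)

      b-injective : Injective _≡_ _≡_ b
      b-injective {i} {j} eq = trans (sym (fb i)) (trans (cong f eq) (fb j))

      b-sep : ∀ {i j} → i ≢ j → b i ≢ b j
      b-sep i≢j eq = i≢j (b-injective eq)

      -- Only five colours may be available, so w can avoid just one value r
      -- besides i, j, m; this suffices when one of p, q is among i, j, m.
      cherry : ∀ i j m r → i ≢ j → j ≢ m → e i j ≡ p → e j m ≡ q →
        i ≢ p → i ≢ q → p ≢ q →
        (∀ {w} → w ≢ i → w ≢ j → w ≢ m → w ≢ r → w ≢ p × w ≢ q) → ⊥
      cherry i j m r ij jm eij ejm ip iq pq avoid =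
        let w , wi , wj , wm , wr = fresh 5≤k i j m r
            wp , wq = avoid wi wj wm wr
        in noTail (b w) (b i) (b j) (b m) (b≢a w) (b≢a i) (b≢a m)
             (b-sep ij) (b-sep jm) (b-sep wj) (b-sep wm) (fb w) (fb i) eij ejm
             wi wp wq ip iq pq

      -- Let `q = e i m` differ from `i`. If `q ≢ j`, the path w, a, b j, b i, b m has colours w, j,
      -- i, q; if `q ≡ j`, the path w, a, b m, b i, b j has colours w, m, j, i.
      absorb-star : ∀ {i j} → i ≢ j → e i j ≡ i → ∀ m → i ≢ m → e i m ≡ i
      absorb-star {i} {j} i≢j eij m i≢m with e i m ≟ i | e i m ≟ j
      ... | yes q≡i | _ = q≡i
      ... | no q≢i | no q≢j =
        ⊥-elim (cherry j i m (e i m) (≢-sym i≢j) i≢m (trans (e-sym j i) eij) refl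
          (≢-sym i≢j) (≢-sym q≢j) (≢-sym q≢i) (λ _ wi _ wq → wi , wq))
      ... | no q≢i | yes q≡j =
        ⊥-elim (cherry m i j j (≢-sym i≢m) i≢j (trans (e-sym m i) q≡j) eij
          (λ m≡j → q≢i (trans (cong (e i) m≡j) eij)) (≢-sym i≢m) (≢-sym i≢j)
          (λ _ wi wj _ → wj , wi))

      -- Away from `b i`, an edge of another colour `q` extends by an edge of the star: w, a, b m, b
      -- j, b i has colours w, m, q, i, and for `q ≡ m` the path w, a, b j, b m, b i has colours w,
      -- j, m, i.
      absorb-all : ∀ {i} → (∀ m → i ≢ m → e i m ≡ i) → ∀ j m → j ≢ m → e j m ≡ i
      absorb-all {i} star j m j≢m with i ≟ j | i ≟ m
      ... | yes refl | _ = star m j≢m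
      ... | no _ | yes refl = trans (e-sym j m) (star j (≢-sym j≢m))
      ... | no i≢j | no i≢m with e j m ≟ i | e j m ≟ m
      ... | yes q≡i | _ = q≡i
      ... | no q≢i | no q≢m =
        ⊥-elim (cherry m j i (e j m) (≢-sym j≢m) (≢-sym i≢j) (e-sym m j)
          (trans (e-sym j i) (star j i≢j)) (≢-sym q≢m) (≢-sym i≢m) q≢i
          (λ _ _ wi wq → wq , wi))
      ... | no q≢i | yes q≡m =
        ⊥-elim (cherry j m i m j≢m (≢-sym i≢m) q≡m (trans (e-sym m i) (star m i≢m))
          j≢m (≢-sym i≢j) (≢-sym i≢m) (λ _ wm wi _ → wm , wi))

      module _ (noAbsorb : ∀ i j → i ≢ j → e i j ≢ i) where

        noAbsorb′ : ∀ i j → i ≢ j → e i j ≢ j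
        noAbsorb′ i j i≢j eq = noAbsorb j i (≢-sym i≢j) (trans (e-sym j i) eq)

        -- Otherwise w, a, b i, b j, b p is rainbow. Applied in both orders of `i` and `j`, this
        -- labels each edge of the triangle on b i, b j, b p by the opposite vertex.
        triangle : ∀ {i j p} → i ≢ j → e i j ≡ p → e j p ≡ i
        triangle {i} {j} i≢j refl with e j (e i j) ≟ i
        ... | yes eq = eq
        ... | no q≢i =
          ⊥-elim (cherry i j (e i j) (e j (e i j)) i≢j j≢p refl refl
            (≢-sym (noAbsorb i j i≢j)) (≢-sym q≢i) (≢-sym (noAbsorb′ j (e i j) j≢p))
            (λ _ _ wp wq → wp , wq))
          where
          j≢p : j ≢ e i j
          j≢p = ≢-sym (noAbsorb′ i j i≢j)

        -- A vertex `b m` outside the triangle on i, j, p breaks it: if `e j m ≡ i`, the path w, a,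
        -- b m, b j, b i has colours w, m, i, p; otherwise b j, b m, a, b i, b p has colours e j m,
        -- m, i, j.
        absurd : ∀ {i j} → i ≢ j → ⊥
        absurd {i} {j} i≢j with e i j in eij
        ... | p with fresh 5≤k i j p p
        ... | m , m≢i , m≢j , m≢p , _ with e j m ≟ i
        ... | yes r≡i =
          cherry m j i p m≢j (≢-sym i≢j) (trans (e-sym m j) r≡i) (trans (e-sym j i) eij)
            m≢i m≢p (λ i≡p → noAbsorb i j i≢j (trans eij (sym i≡p)))
            (λ _ _ wi wp → wi , wp)
        ... | no r≢i =
          noMiddle (b j) (b m) (b i) (b p) (b≢a m) (b≢a i)
            (b-sep (≢-sym m≢j)) (b-sep i≢p) (b-sep (≢-sym i≢j)) (b-sep m≢p) (b-sep j≢p)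
            refl (fb m) (fb i) (triangle (≢-sym i≢j) (trans (e-sym j i) eij))
            (noAbsorb′ j m (≢-sym m≢j)) r≢i (noAbsorb j m (≢-sym m≢j)) m≢i m≢j i≢j
          where
          i≢p : i ≢ p
          i≢p i≡p = noAbsorb i j i≢j (trans eij (sym i≡p))
          j≢p : j ≢ p
          j≢p j≡p = noAbsorb′ i j i≢j (trans eij (sym j≡p))

      monoClique : MonoClique k col
      monoClique with any? (λ i → any? (λ j → ¬? (i ≟ j) ×-dec (e i j ≟ i)))
      ... | yes (i , j , i≢j , eij) = b , b-injective , i , absorb-all (absorb-star i≢j eij)
      ... | no none =
        let i = fromℕ< 5≤k
            j , j≢i , _ = fresh 5≤k i i i i
        in ⊥-elim (absurd (λ i j i≢j eij → none (i , j , i≢j , eij)) j≢i)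

    -- The centre misses exactly one colour.

    module OneMissing {c} (c-unseen : Unseen c) (seen : ∀ i → i ≢ c → ∃[ u ] u ≢ a × f u ≡ i) where

      -- At least four colours are seen at `a`, so one is left beyond any three.
      pick : ∀ p q r → ∃[ w ] w ≢ a × f w ≢ p × f w ≢ q × f w ≢ r
      pick p q r with fresh 5≤k c p q r
      ... | i , i≢c , i≢p , i≢q , i≢r with seen i i≢c
      ... | w , w≢a , refl = w , w≢a , i≢p , i≢q , i≢r

      -- A path through `a` in the middle joins the two edges. Its colours are `c`, two colours seen
      -- at `a`, and `col z w`; the ends next to `a` are chosen so that `col z w` does not repeat.
      opposite : ∀ {x y z w} → x ≢ a → y ≢ a → z ≢ a → w ≢ a →
        f x ≢ f y → f x ≢ f z → f x ≢ f w → f y ≢ f z → f y ≢ f w → f z ≢ f w →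
        col x y ≡ c → col z w ≡ c
      opposite {x} {y} {z} {w} xa ya za wa xy xz xw yz yw zw exy
        with col z w ≟ c | col z w ≟ f z | col z w ≟ f y
      ... | yes s≡c | _ | _ = s≡c
      ... | no s≢c | yes s≡fz | _ =
        ⊥-elim (noMiddle x y w z ya wa (f-sep xy) (f-sep (≢-sym zw)) (f-sep xw) (f-sep yz) (f-sep xz)
          exy refl refl (trans (col-sym w z) s≡fz)
          (≢-sym (c-unseen y ya)) (≢-sym (c-unseen w wa)) (≢-sym (c-unseen z za)) yw yz (≢-sym zw))
      ... | no s≢c | no s≢fz | yes s≡fy =
        ⊥-elim (noMiddle y x z w xa za (f-sep (≢-sym xy)) (f-sep zw) (f-sep yz) (f-sep xw) (f-sep yw)
          (edge-sym exy) refl refl s≡fy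
          (≢-sym (c-unseen x xa)) (≢-sym (c-unseen z za)) (≢-sym (c-unseen y ya)) xz xy (≢-sym yz))
      ... | no s≢c | no s≢fz | no s≢fy =
        ⊥-elim (noMiddle x y z w ya za (f-sep xy) (f-sep zw) (f-sep xz) (f-sep yw) (f-sep xw)
          exy refl refl refl
          (≢-sym (c-unseen y ya)) (≢-sym (c-unseen z za)) (≢-sym s≢c) yz (≢-sym s≢fy) (≢-sym s≢fz))

      -- A fourth neighbour `w` has `col z w ≡ c` by `opposite`; any other colour on `y z` then
      -- completes a rainbow path with one of the two `c`-edges.
      spread : ∀ {x y z} → x ≢ a → y ≢ a → z ≢ a → f x ≢ f y → f x ≢ f z → f y ≢ f z →
        col x y ≡ c → col y z ≡ c
      spread {x} {y} {z} xa ya za xy xz yz exy with pick (f x) (f y) (f z)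
      ... | w , wa , wx , wy , wz
        with opposite xa ya za wa xy xz (≢-sym wx) yz (≢-sym wy) (≢-sym wz) exy
      ... | ezw with col y z ≟ c | col y z ≟ f w | col y z ≟ f z
      ... | yes q≡c | _ | _ = q≡c
      ... | no q≢c | yes q≡fw | _ =
        ⊥-elim (noTail x y z w xa ya wa (f-sep yz) (f-sep (≢-sym wz)) (f-sep xz) (f-sep (≢-sym wx))
          refl refl q≡fw ezw
          xy (≢-sym wx) (c-unseen x xa) (≢-sym wy) (c-unseen y ya) (c-unseen w wa))
      ... | no q≢c | no q≢fw | yes q≡fz =
        ⊥-elim (noTail w x y z wa xa za (f-sep xy) (f-sep yz) (f-sep wy) (f-sep wz)
          refl refl exy q≡fz
          wx (c-unseen w wa) wz (c-unseen x xa) xz (≢-sym (c-unseen z za)))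
      ... | no q≢c | no q≢fw | no q≢fz =
        ⊥-elim (noTail w z y x wa za xa (f-sep (≢-sym yz)) (f-sep (≢-sym xy)) (f-sep wy) (f-sep wx)
          refl refl (col-sym z y) (edge-sym exy)
          wz (≢-sym q≢fw) (c-unseen w wa) (≢-sym q≢fz) (c-unseen z za) q≢c)

      -- If both ends have the same colour to `a`, an edge from `v` to a vertex `x` of another class
      -- must itself have colour `c`: otherwise it forms, with `u v` and two edges at `a`, a rainbow
      -- path.
      separated-edge : ∀ {u v} → u ≢ a → v ≢ a → u ≢ v → col u v ≡ c →
        ∃₂ λ x y → x ≢ a × y ≢ a × f x ≢ f y × col x y ≡ c
      separated-edge {u} {v} ua va uv euv with f u ≟ f v
      ... | no fu≢fv = u , v , ua , va , fu≢fv , euv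
      ... | yes fu≡fv with pick (f u) (f u) (f u)
      ... | x , xa , xu , _ with col v x ≟ c
      ... | yes evx = v , x , va , xa , (λ eq → xu (sym (trans fu≡fv eq))) , evx
      ... | no q≢c with pick (f u) (f x) (col v x)
      ... | w , wa , wu , wx , wq with col v x ≟ f u
      ... | yes q≡fu =
        ⊥-elim (noTail w x v u wa xa ua (≢-sym v≢x) (≢-sym uv) w≢v (f-sep wu)
          refl refl (edge-sym q≡fu) (edge-sym euv)
          wx wu (c-unseen w wa) xu (c-unseen x xa) (c-unseen u ua))
        where
        v≢x : v ≢ x
        v≢x refl = xu (sym fu≡fv)
        w≢v : w ≢ v
        w≢v refl = wu (sym fu≡fv)
      ... | no q≢fu =
        ⊥-elim (noTail w u v x wa ua xa uv (λ { refl → xu (sym fu≡fv) })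
          (λ { refl → wu (sym fu≡fv) }) (f-sep wx) refl refl euv refl
          wu (c-unseen w wa) wq (c-unseen u ua) (≢-sym q≢fu) (≢-sym q≢c))

      module _ {x y} (xa : x ≢ a) (ya : y ≢ a) (xy : f x ≢ f y) (exy : col x y ≡ c) where

        -- Starting from `x y`, colour `c` is carried by `spread` to `z`, with a detour over a third
        -- class `w` when `z` shares its class with `x` or `y`.
        incident : ∀ z → z ≢ a → ∃[ z′ ] z′ ≢ a × f z′ ≢ f z × col z′ z ≡ c
        incident z za with f z ≟ f x
        ... | yes zx with pick (f x) (f y) (f y)
        ... | w , wa , wx , wy , _ =
          w , wa , (λ wz → wx (trans wz zx)) ,
          spread ya wa za (≢-sym wy) (λ yz → xy (sym (trans yz zx))) (λ wz → wx (trans wz zx))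
            (spread xa ya wa xy (≢-sym wx) (≢-sym wy) exy)
        incident z za | no zx with f z ≟ f y
        ... | no zy = y , ya , ≢-sym zy , spread xa ya za xy (≢-sym zx) (≢-sym zy) exy
        ... | yes zy with pick (f x) (f y) (f y)
        ... | w , wa , wx , wy , _ =
          w , wa , (λ wz → wy (trans wz zy)) ,
          spread xa wa za (≢-sym wx) (≢-sym zx) (λ wz → wy (trans wz zy))
            (spread ya xa wa (≢-sym xy) (≢-sym wy) (≢-sym wx) (edge-sym exy))

        mono-separated : ∀ u v → u ≢ a → v ≢ a → f u ≢ f v → col u v ≡ c
        mono-separated u v ua va uv with incident u ua
        ... | u′ , u′a , u′u , eu′u with f u′ ≟ f v
        ... | no u′v = spread u′a ua va u′u u′v uv eu′u
        ... | yes _ with pick (f u) (f v) (f u′)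
        ... | w , wa , wu , wv , wu′ =
          spread wa ua va wu wv uv
            (edge-sym (spread u′a ua wa u′u (≢-sym wu′) (≢-sym wu) eu′u))

        mono : ∀ u v → u ≢ a → v ≢ a → u ≢ v → col u v ≡ c
        mono u v ua va uv with col u v ≟ c
        ... | yes eq = eq
        ... | no p≢c with pick (f u) (f v) (col u v)
        ... | z , za , zu , zv , zp with pick (f u) (col u v) (f z)
        ... | w , wa , wu , wp , wz with f u ≟ f v
        ... | no fu≢fv = mono-separated u v ua va fu≢fv
        -- Inside a class, the path w, a, z, v, u has colours `f w`, `f z`, `c`, `col u v`.
        ... | yes fu≡fv =
          ⊥-elim (noTail w z v u wa za ua (f-sep zv) (≢-sym uv)
            (f-sep (λ wv → wu (trans wv (sym fu≡fv)))) (f-sep wu)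
            refl refl (mono-separated z v za va zv) (col-sym v u)
            wz (c-unseen w wa) wp (c-unseen z za) zp (≢-sym p≢c))

    -- The centre misses two colours.

    module TwoMissing (5≤n : 5 ≤ n)
      {w₁ w₂ w₃} (w₁a : w₁ ≢ a) (w₂a : w₂ ≢ a) (w₃a : w₃ ≢ a)
      (w₁₂ : f w₁ ≢ f w₂) (w₁₃ : f w₁ ≢ f w₃) (w₂₃ : f w₂ ≢ f w₃)
      where

      -- The path w, a, u, v, y forces `f w ≡ f u` for every further `w`, and its reversal forces
      -- `f w ≡ f y`. A fifth vertex equates the two, so `f` is constant off `a` and `v`, too few
      -- values for `w₁`, `w₂`, `w₃`.
      noCherry : ∀ {c c′ u v y} → Unseen c → Unseen c′ → c ≢ c′ →
        u ≢ a → v ≢ a → y ≢ a → u ≢ v → v ≢ y → col u v ≡ c → col v y ≡ c′ → ⊥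
      noCherry {c} {c′} {u} {v} {y} unc unc′ cc′ ua va ya uv vy euv evy =
        conclude (class w₁ w₁a) (class w₂ w₂a) (class w₃ w₃a)
        where
        fw≡fu : ∀ w → w ≢ a → w ≢ v → w ≢ y → f w ≡ f u
        fw≡fu w wa wv wy = decidable-stable (f w ≟ f u) λ ne →
          noTail w u v y wa ua ya uv vy wv wy refl refl euv evy
            ne (unc w wa) (unc′ w wa) (unc u ua) (unc′ u ua) cc′

        fw≡fy : ∀ w → w ≢ a → w ≢ v → w ≢ u → f w ≡ f y
        fw≡fy w wa wv wu = decidable-stable (f w ≟ f y) λ ne →
          noTail w y v u wa ya ua (≢-sym vy) (≢-sym uv) wv wu refl refl (edge-sym evy) (edge-sym euv)
            ne (unc′ w wa) (unc w wa) (unc′ y ya) (unc y ya) (≢-sym cc′)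

        fy≡fu : f y ≡ f u
        fy≡fu with fresh 5≤n a u v y
        ... | w , wa , wu , wv , wy = trans (sym (fw≡fy w wa wv wu)) (fw≡fu w wa wv wy)

        class : ∀ w → w ≢ a → w ≡ v ⊎ f w ≡ f u
        class w wa with w ≟ v | w ≟ y
        ... | yes w≡v | _ = inj₁ w≡v
        ... | no _ | yes refl = inj₂ fy≡fu
        ... | no w≢v | no w≢y = inj₂ (fw≡fu w wa w≢v w≢y)

        sameClass : ∀ {w w′} → (w ≡ v × w′ ≡ v) ⊎ (f w ≡ f u × f w′ ≡ f u) → f w ≡ f w′
        sameClass (inj₁ (refl , refl)) = refl
        sameClass (inj₂ (p , q)) = trans p (sym q)

        -- Two of the three vertices fall on the same side.
        conclude : w₁ ≡ v ⊎ f w₁ ≡ f u → w₂ ≡ v ⊎ f w₂ ≡ f u → w₃ ≡ v ⊎ f w₃ ≡ f u → ⊥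
        conclude (inj₁ p) (inj₁ q) _        = w₁₂ (sameClass (inj₁ (p , q)))
        conclude (inj₂ p) (inj₂ q) _        = w₁₂ (sameClass (inj₂ (p , q)))
        conclude (inj₁ p) (inj₂ _) (inj₁ r) = w₁₃ (sameClass (inj₁ (p , r)))
        conclude (inj₁ _) (inj₂ q) (inj₂ r) = w₂₃ (sameClass (inj₂ (q , r)))
        conclude (inj₂ _) (inj₁ q) (inj₁ r) = w₂₃ (sameClass (inj₁ (q , r)))
        conclude (inj₂ p) (inj₁ _) (inj₂ r) = w₁₃ (sameClass (inj₂ (p , r)))

      two-others : ∀ α → ∃₂ λ w w′ → w ≢ a × w′ ≢ a × f w ≢ α × f w′ ≢ α × f w ≢ f w′
      two-others α with f w₁ ≟ α | f w₂ ≟ α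
      ... | yes refl | _ = w₂ , w₃ , w₂a , w₃a , ≢-sym w₁₂ , ≢-sym w₁₃ , w₂₃
      ... | no w₁α | yes refl = w₁ , w₃ , w₁a , w₃a , w₁α , ≢-sym w₂₃ , w₁₃
      ... | no w₁α | no w₂α = w₁ , w₂ , w₁a , w₂a , w₁α , w₂α , w₁₂

      -- First `col v x ≡ α`, since any other colour closes a rainbow path that starts at `w` or
      -- `w′`, or a cherry. Then any colour but `c` on `w u` gives a rainbow path, one of them being
      -- w, u, v, x, y.
      attach : ∀ {c c′ α u v x y w w′} → Unseen c → Unseen c′ → c ≢ c′ →
        u ≢ a → v ≢ a → x ≢ a → y ≢ a → u ≢ v → x ≢ y → u ≢ x → v ≢ x → v ≢ y →
        col u v ≡ c → col x y ≡ c′ → f u ≡ α → f v ≡ α → f x ≡ α → f y ≡ α →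
        w ≢ a → w′ ≢ a → f w ≢ α → f w′ ≢ α → f w ≢ f w′ → col w u ≡ c
      attach {c} {c′} {α} {u} {v} {x} {y} {w} {w′} unc unc′ cc′ ua va xa ya uv xy ux vx vy
        euv exy fu fv fx fy wa w′a wα w′α ww′ = col-wu
        where
        α≢ : ∀ {d} → Unseen d → α ≢ d
        α≢ und refl = und u ua fu

        apart : ∀ {z z′} → f z ≢ α → f z′ ≡ α → z ≢ z′
        apart fz≢α fz′≡α refl = fz≢α fz′≡α

        noExit : ∀ z → z ≢ a → f z ≢ α → col v x ≢ f z → col v x ≢ α → col v x ≢ c → ⊥
        noExit z za zα q≢fz q≢α q≢c =
          noTail z u v x za ua xa uv vx (apart zα fv) (apart zα fx) refl fu euv refl
            zα (unc z za) (≢-sym q≢fz) (α≢ unc) (≢-sym q≢α) (≢-sym q≢c)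

        col-vx : col v x ≡ α
        col-vx with col v x ≟ α | col v x ≟ c | col v x ≟ f w
        ... | yes q≡α | _ | _ = q≡α
        ... | no _ | yes q≡c | _ = ⊥-elim (noCherry unc unc′ cc′ va xa ya vx xy q≡c exy)
        ... | no q≢α | no q≢c | yes q≡fw =
          ⊥-elim (noExit w′ w′a w′α (λ q≡fw′ → ww′ (trans (sym q≡fw) q≡fw′)) q≢α q≢c)
        ... | no q≢α | no q≢c | no q≢fw = ⊥-elim (noExit w wa wα q≢fw q≢α q≢c)

        wu : w ≢ u
        wu = apart wα fu

        col-wu : col w u ≡ c
        col-wu with col w u ≟ c | col w u ≟ f w | col w u ≟ f w′
        ... | yes s≡c | _ | _ = s≡c
        ... | no s≢c | yes s≡fw | _ =
          ⊥-elim (noPath wu uv vx xy (apart wα fx) uy (apart wα fy)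
            s≡fw euv col-vx exy
            (unc w wa) wα (unc′ w wa) (≢-sym (α≢ unc)) cc′ (α≢ unc′))
          where
          uy : u ≢ y
          uy refl = noCherry unc unc′ cc′ va ua xa (≢-sym uv) (≢-sym xy) (edge-sym euv) (edge-sym exy)
        ... | no s≢c | no s≢fw | yes s≡fw′ =
          ⊥-elim (noTail x w u v xa wa va wu uv (≢-sym ux) (≢-sym vx)
            fx refl s≡fw′ euv
            (≢-sym wα) (≢-sym w′α) (α≢ unc) ww′ (unc w wa) (unc w′ w′a))
        ... | no s≢c | no s≢fw | no s≢fw′ =
          ⊥-elim (noTail w′ w u v w′a wa va wu uv (apart w′α fu) (apart w′α fv)
            refl refl refl euv
            (≢-sym ww′) (≢-sym s≢fw′) (unc w′ w′a) (≢-sym s≢fw) (unc w wa) s≢c)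

      -- The two edges are disjoint by `noCherry`, and paths with `a` in the middle put their four
      -- ends in one class. Two uses of `attach` then make `w` the centre of a cherry in `c` and
      -- `c′`.
      absurd : ∀ {c c′ u v x y} → Unseen c → Unseen c′ → c ≢ c′ →
        u ≢ a → v ≢ a → x ≢ a → y ≢ a → u ≢ v → x ≢ y → col u v ≡ c → col x y ≡ c′ → ⊥
      absurd {c} {c′} {u} {v} {x} {y} unc unc′ cc′ ua va xa ya uv xy euv exy
        with two-others (f x)
      ... | w , w′ , wa , w′a , wα , w′α , ww′ =
        noCherry unc unc′ cc′ ua wa xa (≢-sym wu) wx
          (edge-sym (attach unc unc′ cc′ ua va xa ya uv xy ux vx vy euv exy
            fu≡fx fv≡fx refl fy≡fx wa w′a wα w′α ww′))
          (attach unc′ unc (≢-sym cc′) xa ya ua va xy uv (≢-sym ux) (≢-sym uy) (≢-sym vy) exy euv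
            refl fy≡fx fu≡fx fv≡fx wa w′a wα w′α ww′)
        where
        ux : u ≢ x
        ux refl = noCherry unc unc′ cc′ va ua ya (≢-sym uv) xy (edge-sym euv) exy
        uy : u ≢ y
        uy refl = noCherry unc unc′ cc′ va ua xa (≢-sym uv) (≢-sym xy) (edge-sym euv) (edge-sym exy)
        vx : v ≢ x
        vx refl = noCherry unc unc′ cc′ ua va ya uv xy euv exy
        vy : v ≢ y
        vy refl = noCherry unc unc′ cc′ ua va xa uv (≢-sym xy) euv (edge-sym exy)

        fv≡fx : f v ≡ f x
        fv≡fx = decidable-stable (f v ≟ f x) λ ne →
          noMiddle u v x y va xa uv xy ux vy uy euv refl refl exy
            (≢-sym (unc v va)) (≢-sym (unc x xa)) cc′ ne (unc′ v va) (unc′ x xa)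
        fu≡fx : f u ≡ f x
        fu≡fx = decidable-stable (f u ≟ f x) λ ne →
          noMiddle v u x y ua xa (≢-sym uv) xy vx uy vy (edge-sym euv) refl refl exy
            (≢-sym (unc u ua)) (≢-sym (unc x xa)) cc′ ne (unc′ u ua) (unc′ x xa)
        fv≡fy : f v ≡ f y
        fv≡fy = decidable-stable (f v ≟ f y) λ ne →
          noMiddle u v y x va ya uv (≢-sym xy) uy vx ux euv refl refl (edge-sym exy)
            (≢-sym (unc v va)) (≢-sym (unc y ya)) cc′ ne (unc′ v va) (unc′ y ya)
        fy≡fx : f y ≡ f x
        fy≡fx = trans (sym fv≡fy) fv≡fx

        wu : w ≢ u
        wu refl = wα fu≡fx
        wx : w ≢ x
        wx refl = wα refl

-- Colourings with at most two colours at every vertex.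

-- Two edge colours per vertex: any two vertices share the colour of the edge
-- between them, and a pairwise intersecting family of two-element sets is a
-- star or a triangle; five colours exclude the triangle.
module LocallyTwoColored
  (col : Fin n → Fin n → Fin (suc m))
  (col-sym : ∀ u v → col u v ≡ col v u)
  (exact : ∀ i → ∃₂ λ u v → u ≢ v × col u v ≡ i)
  (noThree : ∀ a u v w → u ≢ a → v ≢ a → w ≢ a →
    col a u ≢ col a v → col a u ≢ col a w → col a v ≢ col a w → ⊥)
  (5≤k : 5 ≤ suc m)
  where

  private variable
    a u v w : Fin n
    p q r : Fin (suc m)

  Sees : Fin n → Fin (suc m) → Set
  Sees v i = ∃[ u ] u ≢ v × col v u ≡ i

  sees? : ∀ v i → Dec (Sees v i)
  sees? v i = any? λ u → ¬? (u ≟ v) ×-dec (col v u ≟ i)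

  sees : u ≢ v → Sees v (col v u)
  sees u≢v = _ , u≢v , refl

  sees′ : u ≢ v → Sees v (col u v)
  sees′ u≢v = _ , u≢v , col-sym _ _

  sees-two : Sees a p → Sees a q → Sees a r → p ≢ q → p ≢ r → q ≢ r → ⊥
  sees-two (u , ua , refl) (v , va , refl) (w , wa , refl) = noThree _ u v w ua va wa

  separated : Sees u p → ¬ Sees v p → v ≢ u
  separated up ¬vp refl = ¬vp up

  notDiverse : ¬ (∀ p → ∃[ v ] ¬ Sees v p)
  notDiverse diverse =
    let a , a′ , aa′ , _ = exact zero
        p = col a a′
        ap : Sees a p
        ap = a′ , ≢-sym aa′ , refl
        b , ¬bp = diverse p
        ba : b ≢ a
        ba = separated ap ¬bp
        q = col a b
        aq : Sees a q
        aq = sees ba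
        bq : Sees b q
        bq = sees′ (≢-sym ba)
        b′ , ¬b′q = diverse q
        b′a : b′ ≢ a
        b′a = separated aq ¬b′q
        b′b : b′ ≢ b
        b′b = separated bq ¬b′q
        r = col b b′
        br : Sees b r
        br = sees b′b
        b′r : Sees b′ r
        b′r = sees′ (≢-sym b′b)
        p≢q : p ≢ q
        p≢q = λ p≡q → ¬bp (subst (Sees b) (sym p≡q) bq)
        p≢r : p ≢ r
        p≢r = λ p≡r → ¬bp (subst (Sees b) (sym p≡r) br)
        q≢r : q ≢ r
        q≢r = λ q≡r → ¬b′q (subst (Sees b′) (sym q≡r) b′r)
        only-pq : ∀ {x} → Sees a x → x ≢ q → x ≡ p
        only-pq = λ {x} ax x≢q → decidable-stable (x ≟ p) λ x≢p → sees-two ax ap aq x≢p x≢q p≢q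
        b′p : Sees b′ p
        b′p = subst (Sees b′) (only-pq (sees b′a) (λ eq → ¬b′q (subst (Sees b′) eq (sees′ (≢-sym b′a)))))
                (sees′ (≢-sym b′a))
        -- The vertices `a`, `b`, `b′` see exactly {p, q}, {q, r}, {p, r}. A vertex `d` seeing a
        -- fourth colour `s` joins all three by its single remaining colour, but no colour is common
        -- to the three sets.
        s , s≢p , s≢q , s≢r , _ = fresh 5≤k p q r r
        d , d′ , dd′ , eds = exact s
        ds : Sees d s
        ds = d′ , ≢-sym dd′ , eds
        ¬as : ¬ Sees a s
        ¬as = λ as → sees-two as ap aq s≢p s≢q p≢q
        ¬bs : ¬ Sees b s
        ¬bs = λ bs → sees-two bs bq br s≢q s≢r q≢r
        ¬b′s : ¬ Sees b′ s
        ¬b′s = λ b′s → sees-two b′s b′p b′r s≢p s≢r p≢r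
        differ : ∀ {x} → ¬ Sees x s → x ≢ d
        differ = separated ds
        s≢ : ∀ {x} → ¬ Sees x s → s ≢ col d x
        s≢ = λ {x} ¬xs eq → ¬xs (subst (Sees x) (sym eq) (sees′ (≢-sym (differ ¬xs))))
        same : ∀ {x y} → ¬ Sees x s → ¬ Sees y s → col d x ≡ col d y
        same = λ {x} {y} ¬xs ¬ys → decidable-stable (col d x ≟ col d y)
          (sees-two ds (sees (differ ¬xs)) (sees (differ ¬ys)) (s≢ ¬xs) (s≢ ¬ys))
        ax : Sees a (col d a)
        ax = sees′ (≢-sym (differ ¬as))
        x≢q : col d a ≢ q
        x≢q = λ eq → ¬b′q (subst (Sees b′) (trans (same ¬b′s ¬as) eq) (sees′ (≢-sym (differ ¬b′s))))
    in ¬bp (subst (Sees b) (trans (same ¬bs ¬as) (only-pq ax x≢q)) (sees′ (≢-sym (differ ¬bs))))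

  dominant : ∃[ d ] ∀ v → Sees v d
  dominant with any? (λ d → all? (λ v → sees? v d))
  ... | yes dom = dom
  ... | no none = ⊥-elim (notDiverse λ p →
    ¬∀⟶∃¬ n _ (λ v → sees? v p) (λ all → none (p , all)))

  d : Fin (suc m)
  d = proj₁ dominant

  other? : ∀ v → Dec (∃[ u ] u ≢ v × col v u ≢ d)
  other? v = any? λ u → ¬? (u ≟ v) ×-dec ¬? (col v u ≟ d)

  -- The value d stands for: v sees no colour other than d.
  g : Fin n → Fin (suc m)
  g v with other? v
  ... | yes (u , _) = col v u
  ... | no _ = d

  -- `u` sees `d` and has room for only one further colour, so the choice made by `other?` is
  -- immaterial.
  g-spec : ∀ u v → u ≢ v → col u v ≢ d → g u ≡ col u v
  g-spec u v u≢v uv≢d with other? u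
  ... | no none = contradiction (v , ≢-sym u≢v , uv≢d) none
  ... | yes (w , w≢u , uw≢d) = decidable-stable (col u w ≟ col u v)
    (sees-two (proj₂ dominant u) (sees w≢u) (sees (≢-sym u≢v)) (≢-sym uw≢d) (≢-sym uv≢d))

  cross : ∀ {u v} → g u ≢ g v → col u v ≡ d
  cross {u} {v} gu≢gv = decidable-stable (col u v ≟ d) λ uv≢d →
    let u≢v = λ u≡v → gu≢gv (cong g u≡v)
    in gu≢gv (trans (g-spec u v u≢v uv≢d) (trans (col-sym u v)
         (sym (g-spec v u (≢-sym u≢v) (λ eq → uv≢d (trans (col-sym u v) eq))))))

  rep : ∀ i → i ≢ d → ∃[ v ] g v ≡ i
  rep i i≢d with exact i
  ... | u , v , u≢v , refl = u , g-spec u v u≢v i≢d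

  -- The `m` representatives lie in different classes and are joined by `d` through `cross`; `x`
  -- fills the slot of index `d`.
  transversal : ∀ x (σ : ∀ i → i ≢ d → Fin n) → (∀ i (i≢d : i ≢ d) → g (σ i i≢d) ≡ i) →
    (∀ i (i≢d : i ≢ d) → x ≢ σ i i≢d × col x (σ i i≢d) ≡ d) → MonoClique (suc m) col
  transversal x σ gσ joined = h , (λ {i} {j} → h-injective i j) , d , h-mono
    where
    h : Fin (suc m) → Fin n
    h i with i ≟ d
    ... | yes _ = x
    ... | no i≢d = σ i i≢d

    h-injective : ∀ i j → h i ≡ h j → i ≡ j
    h-injective i j eq with i ≟ d | j ≟ d
    ... | yes i≡d | yes j≡d = trans i≡d (sym j≡d)
    ... | yes _ | no j≢d = contradiction eq (proj₁ (joined j j≢d))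
    ... | no i≢d | yes _ = contradiction (sym eq) (proj₁ (joined i i≢d))
    ... | no i≢d | no j≢d = trans (sym (gσ i i≢d)) (trans (cong g eq) (gσ j j≢d))

    h-mono : ∀ i j → i ≢ j → col (h i) (h j) ≡ d
    h-mono i j i≢j with i ≟ d | j ≟ d
    ... | yes i≡d | yes j≡d = contradiction (trans i≡d (sym j≡d)) i≢j
    ... | yes _ | no j≢d = proj₂ (joined j j≢d)
    ... | no i≢d | yes _ = trans (col-sym _ x) (proj₂ (joined i i≢d))
    ... | no i≢d | no j≢d = cross λ eq → i≢j (trans (sym (gσ i i≢d)) (trans eq (gσ j j≢d)))

  monoClique : m * m < n → MonoClique (suc m) col
  monoClique mm<n with any? (λ x → g x ≟ d)
  ... | yes (x , gx≡d) =
    transversal x (λ i i≢d → proj₁ (rep i i≢d)) (λ i i≢d → proj₂ (rep i i≢d))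
      (λ i i≢d → (λ { refl → ≢rep i i≢d refl }) , cross (≢rep i i≢d))
    where
    ≢rep : ∀ i i≢d → g x ≢ g (proj₁ (rep i i≢d))
    ≢rep i i≢d eq = i≢d (trans (sym (proj₂ (rep i i≢d))) (trans (sym eq) gx≡d))
  -- Now `g` takes only the `m` values other than `d`, so some class has `m + 1` vertices.
  ... | no none = inClass (generalized-pigeonhole (λ v → punchOut (≢-sym (g≢d v))) mm<n)
    where
    g≢d : ∀ v → g v ≢ d
    g≢d v eq = none (v , eq)

    inClass : ∃[ j ] Σ[ h ∈ (Fin (suc m) → Fin n) ] Injective _≡_ _≡_ h ×
                (∀ i → punchOut (≢-sym (g≢d (h i))) ≡ j) → MonoClique (suc m) col
    inClass (_ , h , h-inj , h-class)
      with any? (λ x → any? (λ y → ¬? (x ≟ y) ×-dec (col (h x) (h y) ≟ d)))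
    ... | no none-d = h , h-inj , g (h zero) , λ x y x≢y →
      trans (sym (g-spec (h x) (h y) (λ eq → x≢y (h-inj eq)) (λ eq → none-d (x , y , x≢y , eq))))
        (sameClass x zero)
      where
      sameClass : ∀ x y → g (h x) ≡ g (h y)
      sameClass x y = punchOut-injective (≢-sym (g≢d (h x))) (≢-sym (g≢d (h y)))
        (trans (h-class x) (sym (h-class y)))
    ... | yes (x , y , x≢y , exy) = transversal (h x) σ gσ joined
      where
      sameClass : g (h x) ≡ g (h y)
      sameClass = punchOut-injective (≢-sym (g≢d (h x))) (≢-sym (g≢d (h y)))
        (trans (h-class x) (sym (h-class y)))

      -- The class with an inner edge of colour `d` is represented by one end `h y`, so that the
      -- other end `h x` can be added.
      σ : ∀ i → i ≢ d → Fin n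
      σ i i≢d with i ≟ g (h y)
      ... | yes _ = h y
      ... | no _ = proj₁ (rep i i≢d)

      gσ : ∀ i i≢d → g (σ i i≢d) ≡ i
      gσ i i≢d with i ≟ g (h y)
      ... | yes i≡gy = sym i≡gy
      ... | no _ = proj₂ (rep i i≢d)

      joined : ∀ i i≢d → h x ≢ σ i i≢d × col (h x) (σ i i≢d) ≡ d
      joined i i≢d with i ≟ g (h y)
      ... | yes _ = (λ eq → x≢y (h-inj eq)) , exy
      ... | no i≢gy = (λ eq → ≢rep (cong g eq)) , cross ≢rep
        where
        ≢rep : g (h x) ≢ g (proj₁ (rep i i≢d))
        ≢rep eq = i≢gy (trans (sym (proj₂ (rep i i≢d))) (trans (sym eq) sameClass))

-- The upper bound: assembling the cases.

1+m≤m*m : 2 ≤ m → suc m ≤ m * m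
1+m≤m*m {m} 2≤m = ℕ.≤-trans (ℕ.+-monoˡ-≤ m (ℕ.≤-trans (s≤s z≤n) 2≤m))
  (ℕ.≤-trans (ℕ.+-monoʳ-≤ m (ℕ.m≤m+n m 0)) (ℕ.*-monoˡ-≤ m 2≤m))

ramsey : (col : Fin n → Fin n → Fin (suc m)) → (∀ u v → col u v ≡ col v u) →
  (∀ i → ∃₂ λ u v → u ≢ v × col u v ≡ i) → 5 ≤ suc m → m * m < n →
  (∀ a b c d e → ¬ RainbowPath col a b c d e) → MonoClique (suc m) col
ramsey {n} {m} col col-sym exact 5≤k mm<n rainbowFree
  with any? (λ a → any? λ u → any? λ v → any? λ w →
    ¬? (u ≟ a) ×-dec ¬? (v ≟ a) ×-dec ¬? (w ≟ a) ×-dec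
    ¬? (col a u ≟ col a v) ×-dec ¬? (col a u ≟ col a w) ×-dec ¬? (col a v ≟ col a w))
... | no none = LocallyTwoColored.monoClique col col-sym exact
  (λ a u v w ua va wa uv uw vw → none (a , u , v , w , ua , va , wa , uv , uw , vw)) 5≤k mm<n
... | yes (a , u , v , w , ua , va , wa , uv , uw , vw) = atStar
  where
  open RainbowFree col col-sym rainbowFree 5≤k
  open Star a

  m<n : suc m < n
  m<n = ℕ.≤-<-trans (1+m≤m*m (ℕ.≤-pred (ℕ.≤-trans (s≤s (s≤s (s≤s z≤n))) 5≤k))) mm<n

  seen? : ∀ i → Dec (∃[ x ] x ≢ a × f x ≡ i)
  seen? i = any? λ x → ¬? (x ≟ a) ×-dec (f x ≟ i)

  -- Exactness supplies an edge of colour `c`, and an end at `a` would make `c` seen.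
  awayFrom-a : ∀ {c} → Unseen c → ∃₂ λ x y → x ≢ a × y ≢ a × x ≢ y × col x y ≡ c
  awayFrom-a {c} unseen with exact c
  ... | x , y , x≢y , exy = x , y ,
    (λ { refl → unseen y (≢-sym x≢y) exy }) ,
    (λ { refl → unseen x x≢y (trans (col-sym y x) exy) }) , x≢y , exy

  oneMissing : ∀ {c} → Unseen c → (∀ i → i ≢ c → ∃[ x ] x ≢ a × f x ≡ i) → MonoClique (suc m) col
  oneMissing {c} unseen seen with awayFrom-a unseen
  ... | x , y , xa , ya , xy , exy with OneMissing.separated-edge unseen seen xa ya xy exy
  ... | x′ , y′ , x′a , y′a , fx′≢fy′ , ex′y′ =
    let h , h-inj , h≢a = avoiding a m<n
    in h , h-inj , c , λ i j i≢j →
      OneMissing.mono unseen seen x′a y′a fx′≢fy′ ex′y′ (h i) (h j) (h≢a i) (h≢a j) (i≢j ∘ h-inj)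

  atStar : MonoClique (suc m) col
  atStar with all? seen?
  ... | yes seen = AllSeen.monoClique (λ i → proj₁ (seen i))
    (λ i → proj₁ (proj₂ (seen i))) (λ i → proj₂ (proj₂ (seen i)))
  ... | no ¬all with ¬∀⟶∃¬ (suc m) _ seen? ¬all
  ... | c , ¬seen with any? (λ c′ → ¬? (c ≟ c′) ×-dec ¬? (seen? c′))
  ... | no none = oneMissing (λ x xa eq → ¬seen (x , xa , eq)) λ i i≢c →
    decidable-stable (seen? i) λ ¬s → none (i , ≢-sym i≢c , ¬s)
  ... | yes (c′ , c≢c′ , ¬seen′)
    with awayFrom-a (λ x xa eq → ¬seen (x , xa , eq)) | awayFrom-a (λ x xa eq → ¬seen′ (x , xa , eq))
  ... | x , y , xa , ya , xy , exy | x′ , y′ , x′a , y′a , x′y′ , ex′y′ =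
    ⊥-elim (TwoMissing.absurd (ℕ.≤-trans 5≤k (ℕ.<⇒≤ m<n)) ua va wa uv uw vw
      (λ x xa eq → ¬seen (x , xa , eq)) (λ x xa eq → ¬seen′ (x , xa , eq))
      c≢c′ xa ya x′a y′a xy x′y′ exy ex′y′)

-- Passage between edge colourings and functions on pairs of vertices.

module Total (c : EdgeColoring (suc m) (K n)) where

  open EdgeColoring c

  col : Fin n → Fin n → Fin (suc m)
  col u v with u ≟ v
  ... | yes _ = zero
  ... | no u≢v = color u≢v

  col-color : ∀ {u v} (u≢v : u ≢ v) → col u v ≡ color u≢v
  col-color {u} {v} u≢v with u ≟ v
  ... | yes u≡v = contradiction u≡v u≢v
  -- Two proofs of the same adjacency are compared by going through the reversed edge.
  ... | no u≢v′ = trans (color-sym u≢v′ (≢-sym u≢v′)) (color-sym (≢-sym u≢v′) u≢v)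

  col-sym : ∀ u v → col u v ≡ col v u
  col-sym u v with u ≟ v
  ... | yes refl = sym (col-diag u)
    where
    col-diag : ∀ u → col u u ≡ zero
    col-diag u with u ≟ u
    ... | yes _ = refl
    ... | no u≢u = contradiction refl u≢u
  ... | no u≢v = trans (color-sym u≢v (≢-sym u≢v)) (sym (col-color (≢-sym u≢v)))

  col-exact : ∀ i → ∃₂ λ u v → u ≢ v × col u v ≡ i
  col-exact i with exact i
  ... | u , v , u≢v , eq = u , v , u≢v , trans (col-color u≢v) eq

  -- Finite search makes the alternative between a rainbow path and a monochromatic clique
  -- constructive.
  rainbowPath? : Dec (∃[ v₀ ] ∃[ v₁ ] ∃[ v₂ ] ∃[ v₃ ] ∃[ v₄ ] RainbowPath col v₀ v₁ v₂ v₃ v₄)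
  rainbowPath? = any? λ _ → any? λ _ → any? λ _ → any? λ _ → any? λ _ →
    unique? _≟_ _ ×-dec unique? _≟_ _

  rainbowCopy : ∀ {v₀ v₁ v₂ v₃ v₄} → RainbowPath col v₀ v₁ v₂ v₃ v₄ →
    Σ[ S ∈ Copy (P 5) (K n) ] Rainbow c S
  rainbowCopy {v₀} {v₁} {v₂} {v₃} {v₄} (distinct , rainbow) = S , S-rainbow
    where
    vertex : Fin 5 → Fin n
    vertex = lookup (v₀ ∷ v₁ ∷ v₂ ∷ v₃ ∷ v₄ ∷ [])

    colors : Fin 4 → Fin (suc m)
    colors = lookup (col v₀ v₁ ∷ col v₁ v₂ ∷ col v₂ v₃ ∷ col v₃ v₄ ∷ [])

    S : Copy (P 5) (K n)
    S = record
      { vertex = vertex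
      ; injective = lookup-injective distinct
      ; edge = λ e eq → Graph.irrefl (P 5) (lookup-injective distinct eq) e
      }

    step : ∀ i → col (vertex (inject₁ i)) (vertex (suc i)) ≡ colors i
    step zero = refl
    step (suc zero) = refl
    step (suc (suc zero)) = refl
    step (suc (suc (suc zero))) = refl

    -- Indexing the edges of the path by `Fin 4`, up to orientation, reduces rainbowness to
    -- injectivity of `colors`.
    locate : ∀ u v → Graph.Adj (P 5) u v →
      ∃[ i ] ((u ≡ inject₁ i × v ≡ suc i) ⊎ (u ≡ suc i × v ≡ inject₁ i)) ×
             col (vertex u) (vertex v) ≡ colors i
    locate u (suc i) (inj₁ eq)
      with refl ← toℕ-injective {i = u} (trans (ℕ.suc-injective eq) (sym (toℕ-inject₁ i)))
      = i , inj₁ (refl , refl) , step i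
    locate (suc i) v (inj₂ eq)
      with refl ← toℕ-injective {i = v} (trans (ℕ.suc-injective eq) (sym (toℕ-inject₁ i)))
      = i , inj₂ (refl , refl) , trans (col-sym _ (vertex v)) (step i)

    S-rainbow : Rainbow c S
    S-rainbow {u} {v} {u′} {v′} e e′ eq with locate u v e | locate u′ v′ e′
    ... | i , uv , ci | i′ , uv′ , ci′
      with refl ← lookup-injective rainbow {i} {i′}
             (trans (sym ci) (trans (trans (col-color _) (trans eq (sym (col-color _)))) ci′))
      with uv | uv′
    ... | inj₁ (refl , refl) | inj₁ (refl , refl) = inj₁ (refl , refl)
    ... | inj₁ (refl , refl) | inj₂ (refl , refl) = inj₂ (refl , refl)
    ... | inj₂ (refl , refl) | inj₁ (refl , refl) = inj₂ (refl , refl)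
    ... | inj₂ (refl , refl) | inj₂ (refl , refl) = inj₁ (refl , refl)

  monoCopy : ∀ {t} → MonoClique t col → Σ[ S ∈ Copy (K t) (K n) ] Monochromatic c S
  monoCopy (h , h-inj , i , mono) =
    record { vertex = h ; injective = h-inj ; edge = λ u≢v eq → u≢v (h-inj eq) } ,
    i , λ {u} {v} u≢v → trans (sym (col-color _)) (mono u v u≢v)

  copies : 5 ≤ suc m → m * m < n →
    (Σ[ S ∈ Copy (P 5) (K n) ] Rainbow c S) ⊎ (Σ[ S ∈ Copy (K (suc m)) (K n) ] Monochromatic c S)
  copies 5≤k mm<n with rainbowPath?
  ... | yes (_ , _ , _ , _ , _ , path) = inj₁ (rainbowCopy path)
  ... | no none = inj₂ (monoCopy (ramsey col col-sym col-exact 5≤k mm<n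
    λ v₀ v₁ v₂ v₃ v₄ path → none (v₀ , v₁ , v₂ , v₃ , v₄ , path)))

-- The lower bound: the block colouring.

module Blocks (m : ℕ) where

  block offset : Fin (m * m) → Fin m
  block = proj₁ ∘ remQuot m
  offset = proj₂ ∘ remQuot {m} m

  block-offset-injective : ∀ {u v} → block u ≡ block v → offset u ≡ offset v → u ≡ v
  block-offset-injective {u} {v} bl off =
    trans (sym (combine-remQuot {m} m u)) (trans (cong₂ combine bl off) (combine-remQuot {m} m v))

  col : Fin (m * m) → Fin (m * m) → Fin (suc m)
  col u v with block u ≟ block v
  ... | yes _ = suc (block u)
  ... | no _ = zero

  within : ∀ u v → block u ≡ block v → col u v ≡ suc (block u)
  within u v eq with block u ≟ block v
  ... | yes _ = refl
  ... | no ne = contradiction eq ne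

  between : ∀ u v → block u ≢ block v → col u v ≡ zero
  between u v ne with block u ≟ block v
  ... | yes eq = contradiction eq ne
  ... | no _ = refl

  col-sym : ∀ u v → col u v ≡ col v u
  col-sym u v with block u ≟ block v
  ... | yes eq = trans (cong suc eq) (sym (within v u (sym eq)))
  ... | no ne = sym (between v u (≢-sym ne))

  consecutive : ∀ u v w → col u v ≡ zero ⊎ col v w ≡ zero ⊎ col u v ≡ col v w
  consecutive u v w with block u ≟ block v | block v ≟ block w
  ... | no _ | _ = inj₁ refl
  ... | yes _ | no _ = inj₂ (inj₁ refl)
  ... | yes eq | yes _ = inj₂ (inj₂ (cong suc eq))

  sameBlock : ∀ {u v j} → col u v ≡ suc j → block u ≡ block v
  sameBlock {u} {v} eq with block u ≟ block v
  ... | yes bl = bl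

  differentBlock : ∀ {u v} → col u v ≡ zero → block u ≢ block v
  differentBlock {u} {v} eq bl with () ← trans (sym eq) (within u v bl)

  block-combine : ∀ i j → block (combine i j) ≡ i
  block-combine i j = cong proj₁ (remQuot-combine i j)

  -- `o` and `o′` serve as two blocks for colour zero and as two offsets within block `j` for colour
  -- `suc j`.
  col-exact : ∀ {o o′} → o ≢ o′ → ∀ i → ∃₂ λ u v → u ≢ v × col u v ≡ i
  col-exact {o} {o′} o≢o′ zero =
    combine o o , combine o′ o ,
    (λ eq → o≢o′ (proj₁ (combine-injective o o o′ o eq))) ,
    between _ _ (λ eq → o≢o′ (trans (sym (block-combine o o)) (trans eq (block-combine o′ o))))
  col-exact {o} {o′} o≢o′ (suc j) =
    combine j o , combine j o′ ,
    (λ eq → o≢o′ (proj₂ (combine-injective j o j o′ eq))) ,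
    trans (within _ _ (trans (block-combine j o) (sym (block-combine j o′))))
          (cong suc (block-combine j o))

  coloring : 2 ≤ m → EdgeColoring (suc m) (K (m * m))
  coloring (s≤s (s≤s _)) = record
    { color = λ {u} {v} _ → col u v
    ; color-sym = λ {u} {v} _ _ → col-sym u v
    ; exact = col-exact {zero} {suc zero} λ ()
    }

  -- Of two consecutive edges of a rainbow path one has colour zero, so a
  -- rainbow path has at most three edges.
  noRainbow : (2≤m : 2 ≤ m) (S : Copy (P 5) (K (m * m))) → ¬ Rainbow (coloring 2≤m) S
  noRainbow 2≤m@(s≤s (s≤s _)) S rainbow =
    clash (consecutive (v 0F) (v 1F) (v 2F)) (consecutive (v 2F) (v 3F) (v 4F))
    where
    open import Data.Fin.Patterns using (0F; 1F; 2F; 3F; 4F)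
    open Copy S renaming (vertex to v)

    e₀₁ : Graph.Adj (P 5) 0F 1F
    e₀₁ = inj₁ refl
    e₁₂ : Graph.Adj (P 5) 1F 2F
    e₁₂ = inj₁ refl
    e₂₃ : Graph.Adj (P 5) 2F 3F
    e₂₃ = inj₁ refl
    e₃₄ : Graph.Adj (P 5) 3F 4F
    e₃₄ = inj₁ refl

    clash : col (v 0F) (v 1F) ≡ zero ⊎ col (v 1F) (v 2F) ≡ zero ⊎ col (v 0F) (v 1F) ≡ col (v 1F) (v 2F) →
            col (v 2F) (v 3F) ≡ zero ⊎ col (v 3F) (v 4F) ≡ zero ⊎ col (v 2F) (v 3F) ≡ col (v 3F) (v 4F) → ⊥
    clash (inj₂ (inj₂ eq)) _ with rainbow e₀₁ e₁₂ eq
    ... | inj₁ (() , _)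
    ... | inj₂ (() , _)
    clash (inj₁ _) (inj₂ (inj₂ eq)) with rainbow e₂₃ e₃₄ eq
    ... | inj₁ (() , _)
    ... | inj₂ (() , _)
    clash (inj₂ (inj₁ _)) (inj₂ (inj₂ eq)) with rainbow e₂₃ e₃₄ eq
    ... | inj₁ (() , _)
    ... | inj₂ (() , _)
    clash (inj₁ p) (inj₁ q) with rainbow e₀₁ e₂₃ (trans p (sym q))
    ... | inj₁ (() , _)
    ... | inj₂ (() , _)
    clash (inj₁ p) (inj₂ (inj₁ q)) with rainbow e₀₁ e₃₄ (trans p (sym q))
    ... | inj₁ (() , _)
    ... | inj₂ (() , _)
    clash (inj₂ (inj₁ p)) (inj₁ q) with rainbow e₁₂ e₂₃ (trans p (sym q))
    ... | inj₁ (() , _)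
    ... | inj₂ (() , _)
    clash (inj₂ (inj₁ p)) (inj₂ (inj₁ q)) with rainbow e₁₂ e₃₄ (trans p (sym q))
    ... | inj₁ (() , _)
    ... | inj₂ (() , _)

  -- A clique of colour zero has its vertices in different blocks; one of any other colour lies in a
  -- single block and has different offsets. Either way it has at most `m` vertices.
  noMono : (2≤m : 2 ≤ m) (S : Copy (K (suc m)) (K (m * m))) → ¬ Monochromatic (coloring 2≤m) S
  noMono 2≤m@(s≤s (s≤s _)) S (zero , mono) =
    ℕ.1+n≰n (injective⇒≤ {f = block ∘ vertex} λ {x} {y} bl →
      decidable-stable (x ≟ y) λ x≢y → differentBlock (mono x≢y) bl)
    where open Copy S
  noMono 2≤m@(s≤s (s≤s _)) S (suc j , mono) =
    ℕ.1+n≰n (injective⇒≤ {f = offset ∘ vertex} λ {x} {y} off →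
      decidable-stable (x ≟ y) λ x≢y →
        x≢y (injective (block-offset-injective (sameBlock (mono x≢y)) off)))
    where open Copy S

-- The binomial condition and the exact value.

n≤[n+1]C2 : ∀ n → n ≤ suc n C 2
n≤[n+1]C2 n = ℕ.≤-trans (ℕ.≤-reflexive (sym (nC1≡n n)))
  (ℕ.≤-trans (ℕ.m≤m+n (n C 1) (n C 2)) (ℕ.≤-reflexive (nCk+nC[k+1]≡[n+1]C[k+1] n 1)))

theorem2p4 : (k t : ℕ) → k ≥ 5 → k ≡ t →
    gr[ k , P 5 ∶ K t ]≡ ((t ∸ 1) ^ 2 + 1)
theorem2p4 (suc m) _ 5≤k refl
  -- This brings the value to `suc (m * m)`, so that `n ≥ N` becomes `m * m < n`.
  rewrite ℕ.*-identityʳ m | ℕ.+-comm (m * m) 1 =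
  (ℕ.≤-trans (1+m≤m*m 2≤m) (n≤[n+1]C2 (m * m)) , λ n mm<n c → Total.copies c 5≤k mm<n) ,
  -- A bound `M ≤ m * m` would apply to the block colouring on `m * m` vertices.
  λ M (_ , bound) → ℕ.≰⇒> λ M≤mm →
    [ uncurry (Blocks.noRainbow m 2≤m) , uncurry (Blocks.noMono m 2≤m) ]′
      (bound (m * m) M≤mm (Blocks.coloring m 2≤m))
  where
  2≤m : 2 ≤ m
  2≤m = ℕ.≤-pred (ℕ.≤-trans (s≤s (s≤s (s≤s z≤n))) 5≤k)
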